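{- Let $n\geq1$ and let $X$ be a symmetric $2n\times 2n$ matrix with zero diagonal and off-diagonal coefficients $x_{i,j}\in\{\pm1\}$. For $1\leq i\leq 2n$ define $$\epsilon_i=\epsilon_i(X)=\prod_{j\neq i}x_{i,j}\ \prod_{1\leq s<t\leq 2n}x_{s,t}\in\{\pm1\}.$$ Then the sign $\epsilon_i$ is well-defined on the switching class: for every diagonal matrix $D$ with diagonal entries in $\{\pm1\}$ and every $i$, $\epsilon_i(DXD)=\epsilon_i(X)$. Moreover, the two subsets $R_+=\{i\mid\epsilon_i=1\}$ and $R_-=\{i\mid\epsilon_i=-1\}$ of the set of row indices $\{1,\dots,2n\}$ both have even cardinality.
   Context: A switching class is an equivalence class of symmetric matrices with zero diagonal and off-diagonal coefficients in $\{\pm1\}$ under the relation $X\sim D\,P^t\,X\,P\,D$ with $P$ a permutation matrix (relabeling of the rows) and $D$ a diagonal matrix with diagonal entries in $\{\pm1\}$ (switching). -}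

module Defs where

open import Algebra.Properties.CommutativeMonoid.Sum as CMSum using ()
open import Data.Bool.Base using (if_then_else_)
open import Data.Fin.Base using (Fin)
open import Data.Fin.Properties as Fin using (_<?_)
open import Data.Fin.Subset using (Subset)
open import Data.Integer.Base using (ℤ; 0ℤ; 1ℤ; -1ℤ; _*_)
open import Data.Integer.Properties as ℤ using (+-0-commutativeMonoid; *-1-commutativeMonoid)
open import Data.Nat.Base using (ℕ)
open import Data.Product.Base using (_×_)
open import Data.Sum.Base using (_⊎_)
open import Data.Vec.Base using (tabulate)
open import Relation.Binary.PropositionalEquality.Core using (_≡_; _≢_)
open import Relation.Nullary.Decidable.Core using (Dec; does; ¬?)

open CMSum +-0-commutativeMonoid using () renaming (sum to ∑) public
open CMSum *-1-commutativeMonoid using () renaming (sum to ∏) public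

Matrix : ℕ → Set
Matrix m = Fin m → Fin m → ℤ

infixl 7 _⊗_

_⊗_ : ∀ {m} → Matrix m → Matrix m → Matrix m
(A ⊗ B) i k = ∑ λ j → A i j * B j k

IsSign : ℤ → Set
IsSign x = x ≡ 1ℤ ⊎ x ≡ -1ℤ

IsSymmetric : ∀ {m} → Matrix m → Set
IsSymmetric X = ∀ i j → X i j ≡ X j i

HasZeroDiagonal : ∀ {m} → Matrix m → Set
HasZeroDiagonal X = ∀ i → X i i ≡ 0ℤ

HasOffDiagonalSigns : ∀ {m} → Matrix m → Set
HasOffDiagonalSigns X = ∀ i j → i ≢ j → IsSign (X i j)

IsDiagonal : ∀ {m} → Matrix m → Set
IsDiagonal D = ∀ i j → i ≢ j → D i j ≡ 0ℤ

IsDiagonalSignMatrix : ∀ {m} → Matrix m → Set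
IsDiagonalSignMatrix D = IsDiagonal D × (∀ i → IsSign (D i i))

-- The product of those f j for which P j holds; the other indices
-- contribute the empty factor 1.
∏-where : ∀ {m p} {P : Fin m → Set p} → (∀ j → Dec (P j)) → (Fin m → ℤ) → ℤ
∏-where P? f = ∏ λ j → if does (P? j) then f j else 1ℤ

ε : ∀ {m} → Matrix m → Fin m → ℤ
ε X i =
  ∏-where (λ j → ¬? (j Fin.≟ i)) (λ j → X i j)
  * ∏ (λ s → ∏-where (λ t → s <? t) (λ t → X s t))

R₊ : ∀ {m} → Matrix m → Subset m
R₊ X = tabulate λ i → does (ε X i ℤ.≟ 1ℤ)

R₋ : ∀ {m} → Matrix m → Subset m
R₋ X = tabulate λ i → does (ε X i ℤ.≟ -1ℤ)

{-# OPTIONS --safe #-}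

-- For signs, the cardinality of R₋ has the parity read off ∏ᵢ εᵢ.  Let T be the
-- product of the entries above the diagonal.  In the product of all row products
-- every such entry occurs twice, so ∏ᵢ εᵢ = T² T²ⁿ = 1.
-- Conjugation by D = diag(d) multiplies each row product by
-- dᵢ²ⁿ⁻² ∏ⱼ dⱼ = ∏ⱼ dⱼ and T by ∏ⱼ dⱼ²ⁿ⁻¹ = ∏ⱼ dⱼ; these two signs cancel in εᵢ.
module Submission where

open import Defs
open import Data.Fin.Base using (Fin)
open import Data.Fin.Subset using (∣_∣)
open import Data.Nat.Base using (ℕ; _*_; _≤_)
open import Data.Nat.Divisibility using (_∣_)
open import Data.Product.Base using (_×_)
open import Relation.Binary.PropositionalEquality.Core using (_≡_)

open import Algebra.Bundles using (CommutativeMonoid)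
import Algebra.Properties.CommutativeMonoid.Sum as Sum
open import Algebra.Properties.CommutativeSemigroup using (interchange)
open import Data.Bool.Base using (if_then_else_; not)
open import Data.Fin.Base using (zero; suc)
open import Data.Fin.Properties as Fin using (_<?_; <-cmp; punchInᵢ≢i)
open import Data.Fin.Subset using (∁)
open import Data.Fin.Subset.Properties using (∣∁p∣≡n∸∣p∣; ∣p∣≤n)
open import Data.Integer.Base using (ℤ; 1ℤ; -1ℤ; 0ℤ; _^_) renaming (_*_ to _·_)
open import Data.Integer.Properties as ℤ using (*-1-commutativeMonoid; +-0-commutativeMonoid)
open import Data.Integer.Tactic.RingSolver using (solve-∀)
open import Data.Nat.Divisibility using (_∣0; n∣n; m∣m*n; ∣m∣n⇒∣m+n; ∣m+n∣m⇒∣n)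
import Data.Nat.Base as ℕ
import Data.Nat.Properties as ℕ
open import Data.Product.Base using (_,_)
open import Data.Sum.Base using (inj₁; inj₂)
open import Data.Vec.Base using (tabulate)
open import Data.Vec.Properties using (tabulate-cong; tabulate-∘)
open import Function.Base using (_∘_)
open import Relation.Binary.Definitions using (tri<; tri≈; tri>)
open import Relation.Binary.PropositionalEquality.Core using (_≢_; refl; sym; trans; cong; cong₂; subst; ≢-sym)
open import Relation.Binary.PropositionalEquality.Properties using (module ≡-Reasoning)
open import Relation.Nullary.Decidable.Core using (Dec; does; yes; no; ¬?)
open import Relation.Nullary.Negation.Core using (¬_; contradiction)

open Sum *-1-commutativeMonoid using () renaming
  (∑-distrib-+ to ∏-distrib-·; ∑-comm to ∏-comm; sum-cong-≗ to ∏-cong)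

open ≡-Reasoning

module _ {a ℓ} (M : CommutativeMonoid a ℓ) where
  open CommutativeMonoid M using (Carrier; _≈_; ∙-congˡ; identityʳ)
    renaming (ε to 0#; trans to ≈-trans)
  open Sum M using (sum; sum-remove; sum-cong-≋; sum-replicate-zero)

  -- Stated for any commutative monoid because it serves twice: additively to collapse matrix
  -- products with a diagonal factor, multiplicatively to isolate one factor of a product.
  sum-singleton : ∀ {m} (f : Fin m → Carrier) i → (∀ j → j ≢ i → f j ≈ 0#) → sum f ≈ f i
  sum-singleton {ℕ.suc m} f i f≈0 =
    ≈-trans (sum-remove {i = i} f)
      (≈-trans (∙-congˡ (≈-trans (sum-cong-≋ (λ j → f≈0 _ (punchInᵢ≢i i j))) (sum-replicate-zero m)))
        (identityʳ (f i)))

-- Signs and the parity of the number of minus ones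

IsSign-· : ∀ {x y} → IsSign x → IsSign y → IsSign (x · y)
IsSign-· (inj₁ refl) (inj₁ refl) = inj₁ refl
IsSign-· (inj₁ refl) (inj₂ refl) = inj₂ refl
IsSign-· (inj₂ refl) (inj₁ refl) = inj₂ refl
IsSign-· (inj₂ refl) (inj₂ refl) = inj₁ refl

sign²≡1 : ∀ {x} → IsSign x → x · x ≡ 1ℤ
sign²≡1 (inj₁ refl) = refl
sign²≡1 (inj₂ refl) = refl

sign-^-even : ∀ {x} n → IsSign x → x ^ (2 * n) ≡ 1ℤ
sign-^-even {x} n sx = begin
  x ^ (2 * n)    ≡⟨ ℤ.^-*-assoc x 2 n ⟨
  (x ^ 2) ^ n    ≡⟨ cong (λ y → (x · y) ^ n) (ℤ.*-identityʳ x) ⟩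
  (x · x) ^ n    ≡⟨ cong (_^ n) (sign²≡1 sx) ⟩
  1ℤ ^ n         ≡⟨ ℤ.^-zeroˡ n ⟩
  1ℤ             ∎

-1^n≡1⇒2∣n : ∀ n → -1ℤ ^ n ≡ 1ℤ → 2 ∣ n
-1^n≡1⇒2∣n 0 _ = 2 ∣0
-- The exponent 1 needs no clause: there the hypothesis computes to `-1ℤ ≡ 1ℤ`, which is absurd.
-1^n≡1⇒2∣n (ℕ.suc (ℕ.suc n)) eq =
  ∣m∣n⇒∣m+n n∣n (-1^n≡1⇒2∣n n (trans (lemma (-1ℤ ^ n)) eq))
  where
  lemma : ∀ x → x ≡ -1ℤ · (-1ℤ · x)
  lemma = solve-∀

∏-const : ∀ m x → ∏ {m} (λ _ → x) ≡ x ^ m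
∏-const 0    x = refl
∏-const (ℕ.suc m) x = cong (x ·_) (∏-const m x)

∏-sign : ∀ {m} (f : Fin m → ℤ) → (∀ i → IsSign (f i)) → IsSign (∏ f)
∏-sign {0}  f sf = inj₁ refl
∏-sign {ℕ.suc m} f sf = IsSign-· (sf zero) (∏-sign (f ∘ suc) (sf ∘ suc))

-- Turns a parity question into the evaluation of a product: a factor 1 leaves both sides alone, and
-- a factor -1 adds one to the count.
∏-signs : ∀ {m} (f : Fin m → ℤ) → (∀ i → IsSign (f i)) →
          ∏ f ≡ -1ℤ ^ ∣ tabulate (λ i → does (f i ℤ.≟ -1ℤ)) ∣
∏-signs {0}  f sf = refl
∏-signs {ℕ.suc m} f sf with f zero | sf zero
... | _ | inj₁ refl = trans (ℤ.*-identityˡ _) (∏-signs (f ∘ suc) (sf ∘ suc))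
... | _ | inj₂ refl = cong (-1ℤ ·_) (∏-signs (f ∘ suc) (sf ∘ suc))

-- Products over decidable sets of indices

module _ {a p} {A : Set a} {P : Set p} {x y : A} where

  if-yes : (P? : Dec P) → P → (if does P? then x else y) ≡ x
  if-yes (yes _) _ = refl
  if-yes (no ¬p) p = contradiction p ¬p

  if-no : (P? : Dec P) → ¬ P → (if does P? then x else y) ≡ y
  if-no (yes p) ¬p = contradiction p ¬p
  if-no (no _)  _  = refl

module _ {m p} {P : Fin m → Set p} (P? : ∀ j → Dec (P j)) where

  restrict : (Fin m → ℤ) → Fin m → ℤ
  restrict f j = if does (P? j) then f j else 1ℤ

  ∏-where-cong : ∀ {f g} → (∀ j → f j ≡ g j) → ∏-where P? f ≡ ∏-where P? g
  ∏-where-cong f≗g = ∏-cong λ j → cong (if does (P? j) then_else 1ℤ) (f≗g j)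

  ∏-where-sign : ∀ f → (∀ j → P j → IsSign (f j)) → IsSign (∏-where P? f)
  ∏-where-sign f sf = ∏-sign _ factor
    where
    factor : ∀ j → IsSign (restrict f j)
    factor j with P? j
    ... | yes p = sf j p
    ... | no _  = inj₁ refl

  ∏-where-distrib-· : ∀ f g → ∏-where P? (λ j → f j · g j) ≡ ∏-where P? f · ∏-where P? g
  ∏-where-distrib-· f g = trans (∏-cong factor) (∏-distrib-· (restrict f) (restrict g))
    where
    factor : ∀ j → restrict (λ k → f k · g k) j ≡ restrict f j · restrict g j
    factor j with P? j
    ... | yes _ = refl
    ... | no _  = refl

∏-where-complement : ∀ {m p} {P : Fin m → Set p} (P? : ∀ j → Dec (P j)) f →
                     ∏-where P? f · ∏-where (¬? ∘ P?) f ≡ ∏ f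
∏-where-complement P? f =
  trans (sym (∏-distrib-· (restrict P? f) (restrict (¬? ∘ P?) f))) (∏-cong factor)
  where
  factor : ∀ j → restrict P? f j · restrict (¬? ∘ P?) f j ≡ f j
  factor j with P? j
  ... | yes _ = ℤ.*-identityʳ (f j)
  ... | no _  = ℤ.*-identityˡ (f j)

-- With this and `∏∏<`, `ε X i` unfolds to `∏≢ i (X i) · ∏∏< X`.
∏≢ : ∀ {m} → Fin m → (Fin m → ℤ) → ℤ
∏≢ i = ∏-where (λ j → ¬? (j Fin.≟ i))

∏∏< : ∀ {m} → Matrix m → ℤ
∏∏< f = ∏ λ s → ∏-where (λ t → s <? t) (f s)

-- Replaces division by `f i`: the indices left out of `∏≢ i` form a singleton, whose product is
-- `f i`.
·-∏≢ : ∀ {m} (i : Fin m) f → f i · ∏≢ i f ≡ ∏ f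
·-∏≢ i f = trans (cong (_· ∏≢ i f) (sym only-i)) (∏-where-complement (Fin._≟ i) f)
  where
  only-i : ∏-where (Fin._≟ i) f ≡ f i
  only-i = trans
    (sum-singleton *-1-commutativeMonoid (restrict (Fin._≟ i) f) i λ j → if-no (j Fin.≟ i))
    (if-yes (i Fin.≟ i) refl)

∏∏<-distrib-· : ∀ {m} (f g : Matrix m) → ∏∏< (λ s t → f s t · g s t) ≡ ∏∏< f · ∏∏< g
∏∏<-distrib-· f g =
  trans (∏-cong λ s → ∏-where-distrib-· (s <?_) (f s) (g s))
        (∏-distrib-· (λ s → ∏-where (s <?_) (f s)) (λ s → ∏-where (s <?_) (g s)))

-- Double counting: an off-diagonal position lies either above or below the diagonal, and
-- transposition carries the lower ones to the upper ones.
∏∏≢≡∏∏< : ∀ {m} (f : Matrix m) → ∏ (λ s → ∏≢ s (f s)) ≡ ∏∏< (λ s t → f s t · f t s)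
∏∏≢≡∏∏< f = sym (begin
  ∏∏< (λ s t → f s t · f t s)
    ≡⟨ ∏∏<-distrib-· f (λ s t → f t s) ⟩
  ∏∏< f · ∏∏< (λ s t → f t s)
    -- Exchanging the two products makes the row index of `f` the outer one, so both halves can be
    -- merged row by row.
    ≡⟨ cong (∏∏< f ·_) (∏-comm λ s → restrict (s <?_) (λ t → f t s)) ⟩
  ∏∏< f · ∏ (λ s → ∏-where (_<? s) (f s))
    ≡⟨ ∏-distrib-· (λ s → ∏-where (s <?_) (f s)) (λ s → ∏-where (_<? s) (f s)) ⟨
  ∏ (λ s → ∏-where (s <?_) (f s) · ∏-where (_<? s) (f s))
    ≡⟨ ∏-cong (λ s → trans
         (sym (∏-distrib-· (restrict (s <?_) (f s)) (restrict (_<? s) (f s))))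
         (∏-cong (factor s))) ⟩
  ∏ (λ s → ∏≢ s (f s)) ∎)
  where
  factor : ∀ s t → restrict (s <?_) (f s) t · restrict (_<? s) (f s) t
                   ≡ restrict (λ u → ¬? (u Fin.≟ s)) (f s) t
  factor s t with <-cmp s t
  ... | tri< s<t s≢t t≮s = trans
    (cong₂ _·_ (if-yes (s <? t) s<t) (if-no (t <? s) t≮s))
    (trans (ℤ.*-identityʳ _) (sym (if-yes (¬? (t Fin.≟ s)) (≢-sym s≢t))))
  -- On the diagonal all three restrictions take the default value 1.
  ... | tri≈ s≮t s≡t t≮s = trans
    (cong₂ _·_ (if-no (s <? t) s≮t) (if-no (t <? s) t≮s))
    (sym (if-no (¬? (t Fin.≟ s)) (λ t≢s → t≢s (sym s≡t))))
  ... | tri> s≮t s≢t t<s = trans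
    (cong₂ _·_ (if-no (s <? t) s≮t) (if-yes (t <? s) t<s))
    (trans (ℤ.*-identityˡ _) (sym (if-yes (¬? (t Fin.≟ s)) (≢-sym s≢t))))

-- Invariance under switching

⊗-diagonals : ∀ {m} {D : Matrix m} → IsDiagonal D → (X : Matrix m) →
              ∀ i k → (D ⊗ X ⊗ D) i k ≡ X i k · (D i i · D k k)
⊗-diagonals {D = D} diag X i k = begin
  (D ⊗ X ⊗ D) i k        ≡⟨ sum-singleton +-0-commutativeMonoid (λ j → (D ⊗ X) i j · D j k) k off-k ⟩
  (D ⊗ X) i k · D k k    ≡⟨ cong (_· D k k)
                              (sum-singleton +-0-commutativeMonoid (λ j → D i j · X j k) i off-i) ⟩
  D i i · X i k · D k k  ≡⟨ lemma (D i i) (X i k) (D k k) ⟩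
  X i k · (D i i · D k k) ∎
  where
  off-k : ∀ j → j ≢ k → (D ⊗ X) i j · D j k ≡ 0ℤ
  off-k j j≢k = trans (cong ((D ⊗ X) i j ·_) (diag j k j≢k)) (ℤ.*-zeroʳ ((D ⊗ X) i j))
  off-i : ∀ j → j ≢ i → D i j · X j k ≡ 0ℤ
  off-i j j≢i = trans (cong (_· X j k) (diag i j (≢-sym j≢i))) (ℤ.*-zeroˡ (X j k))
  lemma : ∀ x y z → x · y · z ≡ y · (x · z)
  lemma = solve-∀

module _ (n : ℕ) where

  -- The even order of the matrix enters the invariance of `ε` through this fact.
  ∏-const-sign : ∀ {x} → IsSign x → ∏ {2 * n} (λ _ → x) ≡ 1ℤ
  ∏-const-sign sx = trans (∏-const (2 * n) _) (sign-^-even n sx)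

  module _ (d : Fin (2 * n) → ℤ) (sd : ∀ i → IsSign (d i)) where

    ∏≢-switching : ∀ i → ∏≢ i (λ j → d i · d j) ≡ ∏ d
    ∏≢-switching i = begin
      ∏≢ i (λ j → d i · d j)                  ≡⟨ ℤ.*-identityˡ _ ⟨
      -- The square `d i · d i` is the factor missing at `j = i`, so inserting it completes the
      -- product.
      1ℤ · ∏≢ i (λ j → d i · d j)             ≡⟨ cong (_· ∏≢ i (λ j → d i · d j)) (sign²≡1 (sd i)) ⟨
      (d i · d i) · ∏≢ i (λ j → d i · d j)    ≡⟨ ·-∏≢ i (λ j → d i · d j) ⟩
      ∏ (λ j → d i · d j)                     ≡⟨ ∏-distrib-· (λ _ → d i) d ⟩
      ∏ {2 * n} (λ _ → d i) · ∏ d             ≡⟨ cong (_· ∏ d) (∏-const-sign (sd i)) ⟩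
      1ℤ · ∏ d                                ≡⟨ ℤ.*-identityˡ _ ⟩
      ∏ d                                     ∎

    -- An odd power of a sign. Two copies of `d i` are inserted: one completes the even power, the
    -- other survives.
    ∏≢-const-sign : ∀ i → ∏≢ i (λ _ → d i) ≡ d i
    ∏≢-const-sign i = begin
      ∏≢ i (λ _ → d i)                  ≡⟨ ℤ.*-identityˡ _ ⟨
      1ℤ · ∏≢ i (λ _ → d i)             ≡⟨ cong (_· ∏≢ i (λ _ → d i)) (sign²≡1 (sd i)) ⟨
      (d i · d i) · ∏≢ i (λ _ → d i)    ≡⟨ ℤ.*-assoc (d i) (d i) _ ⟩
      d i · (d i · ∏≢ i (λ _ → d i))    ≡⟨ cong (d i ·_) (·-∏≢ i (λ _ → d i)) ⟩
      d i · ∏ {2 * n} (λ _ → d i)       ≡⟨ cong (d i ·_) (∏-const-sign (sd i)) ⟩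
      d i · 1ℤ                          ≡⟨ ℤ.*-identityʳ _ ⟩
      d i                               ∎

    -- Double counting for the matrix with constant rows `d s` regroups the pairs by index.
    ∏∏<-switching : ∏∏< (λ s t → d s · d t) ≡ ∏ d
    ∏∏<-switching = trans (sym (∏∏≢≡∏∏< (λ s _ → d s))) (∏-cong ∏≢-const-sign)

  ε-switching : ∀ X (D : Matrix (2 * n)) → IsDiagonalSignMatrix D → ∀ i → ε (D ⊗ X ⊗ D) i ≡ ε X i
  ε-switching X D (diag , sd) i = begin
    ε (D ⊗ X ⊗ D) i
      ≡⟨ cong₂ _·_
           (trans (∏-where-cong (λ j → ¬? (j Fin.≟ i)) (⊗-diagonals diag X i))
                  (∏-where-distrib-· (λ j → ¬? (j Fin.≟ i)) (X i) (λ j → d i · d j)))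
           (trans (∏-cong λ s → ∏-where-cong (s <?_) (⊗-diagonals diag X s))
                  (∏∏<-distrib-· X (λ s t → d s · d t))) ⟩
    (∏≢ i (X i) · ∏≢ i (λ j → d i · d j)) · (∏∏< X · ∏∏< (λ s t → d s · d t))
      ≡⟨ cong₂ (λ p q → (∏≢ i (X i) · p) · (∏∏< X · q)) (∏≢-switching d sd i) (∏∏<-switching d sd) ⟩
    (∏≢ i (X i) · ∏ d) · (∏∏< X · ∏ d)
      ≡⟨ interchange ℤ.*-commutativeSemigroup (∏≢ i (X i)) (∏ d) (∏∏< X) (∏ d) ⟩
    ε X i · (∏ d · ∏ d)
      ≡⟨ cong (ε X i ·_) (sign²≡1 (∏-sign d sd)) ⟩
    ε X i · 1ℤ
      ≡⟨ ℤ.*-identityʳ _ ⟩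
    ε X i ∎
    where
    d : Fin (2 * n) → ℤ
    d i = D i i

-- Parity of the two sets of rows

module _ {m} {X : Matrix m} (signs : HasOffDiagonalSigns X) where

  ∏∏<-sign : IsSign (∏∏< X)
  ∏∏<-sign = ∏-sign _ λ s →
    ∏-where-sign (s <?_) (X s) λ t s<t → signs s t (Fin.<⇒≢ s<t)

  ε-sign : ∀ i → IsSign (ε X i)
  ε-sign i = IsSign-·
    (∏-where-sign (λ j → ¬? (j Fin.≟ i)) (X i) λ j j≢i → signs i j (≢-sym j≢i))
    ∏∏<-sign

  R₊≡∁R₋ : R₊ X ≡ ∁ (R₋ X)
  R₊≡∁R₋ = trans (tabulate-cong λ i → opposite (ε-sign i)) (tabulate-∘ not _)
    where
    opposite : ∀ {x} → IsSign x → does (x ℤ.≟ 1ℤ) ≡ not (does (x ℤ.≟ -1ℤ))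
    opposite (inj₁ refl) = refl
    opposite (inj₂ refl) = refl

module _ (n : ℕ) {X : Matrix (2 * n)} (symm : IsSymmetric X) (signs : HasOffDiagonalSigns X) where

  ∏ε≡1 : ∏ (ε X) ≡ 1ℤ
  ∏ε≡1 = begin
    ∏ (ε X)
      ≡⟨ ∏-distrib-· (λ i → ∏≢ i (X i)) (λ _ → ∏∏< X) ⟩
    ∏ (λ i → ∏≢ i (X i)) · ∏ {2 * n} (λ _ → ∏∏< X)
      -- The second product consists of `2 * n` copies of one sign.
      ≡⟨ cong₂ _·_ (∏∏≢≡∏∏< X) (∏-const-sign n (∏∏<-sign signs)) ⟩
    ∏∏< (λ s t → X s t · X t s) · 1ℤ
      ≡⟨ ℤ.*-identityʳ _ ⟩
    ∏∏< (λ s t → X s t · X t s)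
      -- Symmetry turns each pair of mirrored entries into a square.
      ≡⟨ ∏-cong (λ s → ∏-where-cong (s <?_) λ t → cong (X s t ·_) (symm t s)) ⟩
    ∏∏< (λ s t → X s t · X s t)
      ≡⟨ ∏∏<-distrib-· X X ⟩
    ∏∏< X · ∏∏< X
      ≡⟨ sign²≡1 (∏∏<-sign signs) ⟩
    1ℤ ∎

  2∣∣R₋∣ : 2 ∣ ∣ R₋ X ∣
  2∣∣R₋∣ = -1^n≡1⇒2∣n ∣ R₋ X ∣ (trans (sym (∏-signs (ε X) (ε-sign signs))) ∏ε≡1)

  -- `R₊ X` is the complement of a set of even size among `2 * n` rows.
  2∣∣R₊∣ : 2 ∣ ∣ R₊ X ∣
  2∣∣R₊∣ = ∣m+n∣m⇒∣n (subst (2 ∣_) (sym ∣R₋∣+∣R₊∣≡2n) (m∣m*n n)) 2∣∣R₋∣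
    where
    ∣R₋∣+∣R₊∣≡2n : ∣ R₋ X ∣ ℕ.+ ∣ R₊ X ∣ ≡ 2 * n
    ∣R₋∣+∣R₊∣≡2n = begin
      ∣ R₋ X ∣ ℕ.+ ∣ R₊ X ∣             ≡⟨ cong (λ p → ∣ R₋ X ∣ ℕ.+ ∣ p ∣) (R₊≡∁R₋ signs) ⟩
      ∣ R₋ X ∣ ℕ.+ ∣ ∁ (R₋ X) ∣         ≡⟨ cong (∣ R₋ X ∣ ℕ.+_) (∣∁p∣≡n∸∣p∣ (R₋ X)) ⟩
      ∣ R₋ X ∣ ℕ.+ (2 * n ℕ.∸ ∣ R₋ X ∣) ≡⟨ ℕ.m+[n∸m]≡n (∣p∣≤n (R₋ X)) ⟩
      2 * n                             ∎

mainTheorem3 : ∀ (n : ℕ) → 1 ≤ n →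
    (X : Matrix (2 * n)) →
    IsSymmetric X → HasZeroDiagonal X → HasOffDiagonalSigns X →
    (∀ i → IsSign (ε X i))
    × (∀ (D : Matrix (2 * n)) → IsDiagonalSignMatrix D →
    ∀ (i : Fin (2 * n)) → ε (D ⊗ X ⊗ D) i ≡ ε X i)
    × (2 ∣ ∣ R₊ X ∣)
    × (2 ∣ ∣ R₋ X ∣)
mainTheorem3 n _ X symm _ signs =
  ε-sign signs , ε-switching n X , 2∣∣R₊∣ n symm signs , 2∣∣R₋∣ n symm signs
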